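{- Let $f(x_1,\ldots,x_n)$ be a Boolean function of $n$ variables represented in conjunctive normal form, and let $f(\sigma_1,\ldots,\sigma_n)=1$ for some assignment tuple $(\sigma_1,\ldots,\sigma_n)\in\{0,1\}^n$. If the function $h(x_1,\ldots,x_n)$ is generated by the function $f(x_1,\ldots,x_n)$ as a result of admissible changes under the assignment tuple $(\sigma_1,\ldots,\sigma_n)$, then $h(x_1,\ldots,x_n)$ is also a satisfiable function.
   Context: CNF conventions. A Boolean function $f(x_1,\ldots,x_n)$ in conjunctive normal form (CNF) with $m$ clauses is given as $f=\bigwedge_{i=1}^m c_i$, each clause being $c_i=x_{j_1}^{\alpha_1}\vee\cdots\vee x_{j_k}^{\alpha_k}$ with $k\in\{1,\ldots,n\}$, $\{j_1,\ldots,j_k\}\subseteq\{1,\ldots,n\}$, $\alpha_r\in\{0,1\}$, $x_j^0=\bar x_j$, $x_j^1=x_j$. Standing assumptions: no clause contains both a variable and its negation; every variable $x_j$, $j\in\{1,\ldots,n\}$, occurs (negated or not) in some clause. Clauses are numbered and identified with their numbers, so $S(f)=\{c_1,\ldots,c_m\}$ is an ordered set of $m$ elements. $f$ is satisfiable if $f(\sigma)=1$ for some $\sigma\in\{0,1\}^n$. Special decomposition and covering. For a nonempty ordered set $S=\{e_1,\ldots,e_m\}$, an ordered set $d_nS=\{(M_1^0,M_1^1),\ldots,(M_n^0,M_n^1)\}$ of ordered pairs of subsets of $S$ is a special decomposition of $S$ if for all $i$, $M_i^0\cap M_i^1=\emptyset$ and ($M_i^0\ne\emptyset$ or $M_i^1\neq\emptyset$),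 and $\bigcup_{i}(M_i^0\cup M_i^1)=S$. The ordered set $c_nS=\{M_1^{\alpha_1},\ldots,M_n^{\alpha_n}\}$ is a special covering for $S$ under $d_nS$ if $\bigcup_i M_i^{\alpha_i}=S$. Decomposition generated by $f$. $d_nS(f)=\{(F_1^0,F_1^1),\ldots,(F_n^0,F_n^1)\}$, where $F_i^\alpha$ is the set of clauses $c_j\in S(f)$ containing the literal $x_i^\alpha$. When $f(\sigma_1,\ldots,\sigma_n)=1$, $\{F_1^{\sigma_1},\ldots,F_n^{\sigma_n}\}$ is the associated special covering $c_nS(f)$. Function generated by a special decomposition $d_nS$. $h=\bigwedge_{i=1}^m c_i'$, where $c_i'$ is the disjunction of the literals in $\{x_j^\alpha: e_i\in M_j^\alpha,\ j\in\{1,\ldots,n\},\ \alpha\in\{0,1\}\}$. Admissible changes under a tuple $(\alpha_1,\ldots,\alpha_n)$. Let $c_nS=\{M_1^{\alpha_1},\ldots,M_n^{\alpha_n}\}$ be a special covering under $d_nS$. Write $\bar\delta=1-\delta$; membership of $M_i^\delta$ in $c_nS$ means $\delta=\alpha_i$. The following changes are admissible: (i.1) for $e\in M_i^\delta$, replace $M_i^\delta$ by $M_i^\delta\setminus\{e\}$, if $M_i^\delta\notin c_nS$ and $(M_i^\delta\setminus\{e\})\cup M_i^{\bar\delta}\neq\emptyset$; (i.2) for $e\in S$ with $e\notin M_i^0\cup M_i^1$, replace $M_i^\delta$ by $M_i^\delta\cup\{e\}$; (i.3) if $M_j^\gamma$ and $M_i^\delta$ are both in $c_nS$, then for $e$ with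 $e\in M_j^\gamma$ and $e\notin M_i^{\bar\delta}$, replace $M_j^\gamma$ by $M_j^\gamma\setminus\{e\}$ and $M_i^\delta$ by $M_i^\delta\cup\{e\}$. An ordered set of pairs is generated by $d_nS$ as a result of admissible changes under $(\alpha_1,\ldots,\alpha_n)$ if it is obtained from $d_nS$ by such changes, applied successively, each to the current pairs and with the current covering sets having the same subscripts and superscripts. Generation of functions. $h$ is generated by $f$ as a result of admissible changes under $(\sigma_1,\ldots,\sigma_n)$ if $f(\sigma_1,\ldots,\sigma_n)=1$, $f$ generates the special decomposition $d_nS(f)$, a special decomposition $d_nS(f)G$ is generated by $d_nS(f)$ as a result of admissible changes under $(\sigma_1,\ldots,\sigma_n)$, and $h$ is the function generated by $d_nS(f)G$. -}

module Defs where

open import Data.Bool using (Bool; true; false; not; if_then_else_)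
import Data.Bool.Properties as Bool
open import Data.Bool.ListAction using (any; all)
open import Data.Fin using (Fin)
import Data.Fin.Properties as Fin
open import Data.Fin.Subset using (Subset; ⊤; _∈_; _∉_; _∩_; _∪_; _-_; ⁅_⁆; ⋃; Empty; Nonempty)
open import Data.Fin.Subset.Properties using (_∈?_)
open import Data.List using (List; []; _∷_; allFin; cartesianProduct; filter)
open import Data.List.Membership.Propositional using () renaming (_∈_ to _∈ₗ_)
import Data.List.Membership.DecPropositional as DecMembership
open import Data.List.Relation.Unary.Unique.Propositional using (Unique)
open import Data.Nat using (ℕ; NonZero)
open import Data.Product using (_×_; _,_; ∃-syntax)
open import Data.Product.Properties using (≡-dec)
open import Data.Sum using (_⊎_)
open import Data.Vec using (Vec; lookup; map; tabulate; toList; _[_]%=_)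
open import Relation.Binary.Construct.Closure.ReflexiveTransitive using (Star)
open import Relation.Binary.PropositionalEquality using (_≡_; _≢_)
open import Relation.Nullary using (¬_; does)

private variable
  n m : ℕ

-- The truth values 0 and 1 are false and true throughout, including as
-- superscripts α of x_i^α and M_i^α; ᾱ is not α.
Assignment : ℕ → Set
Assignment n = Vec Bool n

-- (j , α) stands for x_j^α, where x_j^1 = x_j and x_j^0 is its negation.
Literal : ℕ → Set
Literal n = Fin n × Bool

Clause : ℕ → Set
Clause n = List (Literal n)

CNF : ℕ → ℕ → Set
CNF n m = Vec (Clause n) m

evalLiteral : Assignment n → Literal n → Bool
evalLiteral σ (j , α) = if α then lookup σ j else not (lookup σ j)

evalClause : Assignment n → Clause n → Bool
evalClause σ = any (evalLiteral σ)

eval : CNF n m → Assignment n → Bool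
eval f σ = all (evalClause σ) (toList f)

Satisfiable : CNF n m → Set
Satisfiable f = ∃[ σ ] eval f σ ≡ true

-- Together, the three conditions make the variables of a clause pairwise
-- distinct, so that it has between 1 and n literals.
record IsClause (c : Clause n) : Set where
  field
    nonempty   : c ≢ []
    distinct   : Unique c
    consistent : ∀ j → ¬ ((j , false) ∈ₗ c × (j , true) ∈ₗ c)

record IsCNF (f : CNF n m) : Set where
  field
    clauses : ∀ (i : Fin m) → IsClause (lookup f i)
    occurs  : ∀ (j : Fin n) → ∃[ i ] ∃[ α ] (j , α) ∈ₗ lookup f i

-- An ordered set of n pairs (M_i^0 , M_i^1) of subsets of S = {e_1, …, e_m},
-- whose elements are identified with their numbers.
Pairs : ℕ → ℕ → Set
Pairs n m = Vec (Subset m × Subset m) n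

select : Bool → Subset m × Subset m → Subset m
select false (M⁰ , M¹) = M⁰
select true  (M⁰ , M¹) = M¹

put : Bool → Subset m → Subset m × Subset m → Subset m × Subset m
put false N (M⁰ , M¹) = N , M¹
put true  N (M⁰ , M¹) = M⁰ , N

-- M_i^δ
part : Pairs n m → Fin n → Bool → Subset m
part d i δ = select δ (lookup d i)

-- M_i^δ is replaced by N.
replace : Pairs n m → Fin n → Bool → Subset m → Pairs n m
replace d i δ N = d [ i ]%= put δ N

record IsSpecialDecomposition {n m : ℕ} (d : Pairs n m) : Set where
  field
    nonemptySet : NonZero m
    disjoint    : ∀ i → Empty (part d i false ∩ part d i true)
    inhabited   : ∀ i → Nonempty (part d i false) ⊎ Nonempty (part d i true)
    exhaustive  : ⋃ (toList (map (λ (M⁰ , M¹) → M⁰ ∪ M¹) d)) ≡ ⊤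

-- F_i^α, the set of clauses of f containing x_i^α.
clausesWith : CNF n m → Literal n → Subset m
clausesWith f ℓ = map (λ c → does (ℓ ∈ₗ? c)) f
  where open DecMembership (≡-dec Fin._≟_ Bool._≟_) renaming (_∈?_ to _∈ₗ?_)

decomposition : CNF n m → Pairs n m
decomposition f = tabulate λ i → clausesWith f (i , false) , clausesWith f (i , true)

allLiterals : ∀ n → List (Literal n)
allLiterals n = cartesianProduct (allFin n) (false ∷ true ∷ [])

generatedFunction : Pairs n m → CNF n m
generatedFunction {n} d =
  tabulate λ e → filter (λ (j , α) → e ∈? part d j α) (allLiterals n)

-- The covering {M_1^{α_1}, …, M_n^{α_n}} is represented by the tuple α alone:
-- M_i^δ belongs to it iff δ ≡ lookup α i.
data AdmissibleChange (α : Assignment n) (d : Pairs n m) : Pairs n m → Set where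
  remove : ∀ i δ e →
    e ∈ part d i δ →
    δ ≢ lookup α i →
    Nonempty ((part d i δ - e) ∪ part d i (not δ)) →
    AdmissibleChange α d (replace d i δ (part d i δ - e))

  add : ∀ i δ e →
    e ∉ part d i false ∪ part d i true →
    AdmissibleChange α d (replace d i δ (part d i δ ∪ ⁅ e ⁆))

  -- For i = j the second replacement restores the set, so d is unchanged.
  move : ∀ j γ i δ e →
    γ ≡ lookup α j →
    δ ≡ lookup α i →
    e ∈ part d j γ →
    e ∉ part d i (not δ) →
    AdmissibleChange α d
      (replace (replace d j γ (part d j γ - e)) i δ (part d i δ ∪ ⁅ e ⁆))

-- The intermediate ordered sets of pairs need not be special decompositions.
GeneratedPairs : Assignment n → Pairs n m → Pairs n m → Set
GeneratedPairs α = Star (AdmissibleChange α)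

record GeneratedFunction {n m : ℕ} (σ : Assignment n) (f h : CNF n m) : Set where
  field
    satisfies     : eval f σ ≡ true
    G             : Pairs n m
    G-special     : IsSpecialDecomposition G
    G-generated   : GeneratedPairs σ (decomposition f) G
    h-generated   : h ≡ generatedFunction G

{-# OPTIONS --safe #-}

-- An admissible change never uncovers a clause: a removal touches only sets
-- outside the covering, an addition only enlarges a set, and a move takes e out
-- of one covering set only to put it into another. Hence {M_i^{σ_i}} covers S
-- after every change, and this says exactly that σ satisfies the generated CNF.
module Submission where

open import Defs
open import Data.Nat using (ℕ)
open import Data.Bool using (true; false; T)
import Data.Bool.Properties as Bool
import Data.Fin.Properties as Fin
open import Data.Fin.Subset using (Subset; _∈_; _∪_; _-_; ⁅_⁆)
open import Data.Fin.Subset.Properties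
  using (_∈?_; p⊆p∪q; q⊆p∪q; x∈⁅x⁆; x∈p∧x≢y⇒x∈p-y)
open import Data.List.Membership.Propositional using (find; lose) renaming (_∈_ to _∈ₗ_)
open import Data.List.Membership.Propositional.Properties
  using (∈-allFin; ∈-cartesianProduct⁺; ∈-filter⁺)
import Data.List.Membership.DecPropositional as DecMembership
open import Data.List.Relation.Unary.All.Properties using (all⁺; all⁻)
open import Data.List.Relation.Unary.Any using (here; there)
open import Data.List.Relation.Unary.Any.Properties using (any⁺; any⁻)
open import Data.Product using (_,_; proj₁; proj₂; ∃-syntax)
open import Data.Product.Properties using (≡-dec)
open import Data.Vec using (lookup; toList)
open import Data.Vec.Properties
  using (lookup∘updateAt; lookup∘updateAt′; lookup∘tabulate; lookup-map; lookup⇒[]=)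
import Data.Vec.Relation.Unary.All.Properties as Vec
open import Function using (_∘_; Equivalence)
open import Relation.Binary.Construct.Closure.ReflexiveTransitive using (ε; _◅_)
open import Relation.Binary.PropositionalEquality
  using (_≡_; refl; sym; trans; cong; subst)
open import Relation.Nullary using (yes; no; contradiction)
open import Relation.Nullary.Decidable using (dec-true)

private variable
  n m : ℕ

Covers : Assignment n → Pairs n m → Set
Covers α d = ∀ e → ∃[ i ] e ∈ part d i (lookup α i)

-- Of the two literals in `x_i`, the one true under `σ` is `(i , lookup σ i)`. Phrased this way,
-- satisfaction of a clause has the shape of `Covers` at one element, with the same index as
-- witness.
SatisfiesClause : Assignment n → Clause n → Set
SatisfiesClause σ c = ∃[ i ] (i , lookup σ i) ∈ₗ c

evalLiteral⁻ : (σ : Assignment n) → ∀ i α → T (evalLiteral σ (i , α)) → α ≡ lookup σ i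
evalLiteral⁻ σ i false = sym ∘ Equivalence.to Bool.T-not-≡
evalLiteral⁻ σ i true  = sym ∘ Equivalence.to Bool.T-≡

evalLiteral⁺ : (σ : Assignment n) → ∀ i → T (evalLiteral σ (i , lookup σ i))
evalLiteral⁺ σ i with lookup σ i
... | false = _
... | true  = _

evalClause⁻ : (σ : Assignment n) → ∀ c → T (evalClause σ c) → SatisfiesClause σ c
evalClause⁻ σ c t with find (any⁻ (evalLiteral σ) c t)
... | (i , α) , ℓ∈c , tℓ = i , subst (λ β → (i , β) ∈ₗ c) (evalLiteral⁻ σ i α tℓ) ℓ∈c

evalClause⁺ : (σ : Assignment n) → ∀ c → SatisfiesClause σ c → T (evalClause σ c)
evalClause⁺ σ c (i , ℓ∈c) = any⁺ (evalLiteral σ) (lose ℓ∈c (evalLiteral⁺ σ i))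

eval⁻ : (f : CNF n m) (σ : Assignment n) → eval f σ ≡ true →
        ∀ e → SatisfiesClause σ (lookup f e)
eval⁻ f σ fσ e = evalClause⁻ σ (lookup f e)
  (Vec.lookup⁺ (Vec.toList⁻ (all⁺ (evalClause σ) (toList f) (Equivalence.from Bool.T-≡ fσ))) e)

eval⁺ : (f : CNF n m) (σ : Assignment n) →
        (∀ e → SatisfiesClause σ (lookup f e)) → eval f σ ≡ true
eval⁺ f σ sat = Equivalence.to Bool.T-≡
  (all⁻ (evalClause σ) (Vec.toList⁺ (Vec.lookup⁻ {xs = f} λ e → evalClause⁺ σ (lookup f e) (sat e))))

∈-decomposition⁺ : (f : CNF n m) → ∀ i α e →
                   (i , α) ∈ₗ lookup f e → e ∈ part (decomposition f) i α
∈-decomposition⁺ {n = n} f i α e ℓ∈c =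
  -- Membership in a `Subset` says that its Boolean entry is `true`; here that entry is the `does`
  -- of a test for the literal.
  subst (e ∈_) (sym (part-decomposition α)) (lookup⇒[]= e _
    (trans (lookup-map e _ f) (dec-true ((i , α) ∈ₗ? lookup f e) ℓ∈c)))
  where
  open DecMembership (≡-dec (Fin._≟_ {n}) Bool._≟_) using () renaming (_∈?_ to _∈ₗ?_)

  -- `select` computes only on a constructor, hence the split on `α`.
  part-decomposition : ∀ α → part (decomposition f) i α ≡ clausesWith f (i , α)
  part-decomposition false = cong proj₁ (lookup∘tabulate _ i)
  part-decomposition true  = cong proj₂ (lookup∘tabulate _ i)

∈-allLiterals : (ℓ : Literal n) → ℓ ∈ₗ allLiterals n
∈-allLiterals (i , false) = ∈-cartesianProduct⁺ (∈-allFin i) (here refl)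
∈-allLiterals (i , true)  = ∈-cartesianProduct⁺ (∈-allFin i) (there (here refl))

∈-generatedFunction⁺ : (d : Pairs n m) → ∀ i α e →
                       e ∈ part d i α → (i , α) ∈ₗ lookup (generatedFunction d) e
∈-generatedFunction⁺ d i α e e∈M =
  subst ((i , α) ∈ₗ_) (sym (lookup∘tabulate _ e))
    (∈-filter⁺ (λ (j , β) → e ∈? part d j β) (∈-allLiterals (i , α)) e∈M)

-- A true literal of clause `e` names the covering set that contains `e`.
satisfied⇒covers : (f : CNF n m) (σ : Assignment n) →
                   eval f σ ≡ true → Covers σ (decomposition f)
satisfied⇒covers f σ fσ e with eval⁻ f σ fσ e
... | i , ℓ∈c = i , ∈-decomposition⁺ f i (lookup σ i) e ℓ∈c

-- Conversely, the covering set that contains `e` contributes a true literal to the generated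
-- clause.
covers⇒satisfied : (d : Pairs n m) (σ : Assignment n) →
                   Covers σ d → eval (generatedFunction d) σ ≡ true
covers⇒satisfied d σ cov = eval⁺ (generatedFunction d) σ λ e →
  proj₁ (cov e) , ∈-generatedFunction⁺ d _ _ e (proj₂ (cov e))

select-put : ∀ δ (N : Subset m) M → select δ (put δ N M) ≡ N
select-put false N M = refl
select-put true  N M = refl

∈-put⁺ : ∀ δ {N : Subset m} β M {e} →
         e ∈ select β M → (β ≡ δ → e ∈ N) → e ∈ select β (put δ N M)
∈-put⁺ false false M e∈M e∈N = e∈N refl
∈-put⁺ false true  M e∈M e∈N = e∈M
∈-put⁺ true  false M e∈M e∈N = e∈M
∈-put⁺ true  true  M e∈M e∈N = e∈N refl

part-replace : (d : Pairs n m) → ∀ i δ N → part (replace d i δ N) i δ ≡ N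
part-replace d i δ N =
  trans (cong (select δ) (lookup∘updateAt i d)) (select-put δ N (lookup d i))

-- A replacement can harm a membership only if index and superscript both coincide, so membership in
-- `N` is demanded only then. With `β` equal to `lookup α k`, each kind of change leaves just its
-- effect on a covering set to be checked.
∈-replace⁺ : (d : Pairs n m) → ∀ i δ {N} k β {e} → e ∈ part d k β →
             (k ≡ i → β ≡ δ → e ∈ N) → e ∈ part (replace d i δ N) k β
∈-replace⁺ d i δ k β {e} e∈M e∈N with k Fin.≟ i
... | yes refl = subst (λ M → e ∈ select β M) (sym (lookup∘updateAt i d))
                   (∈-put⁺ δ β (lookup d i) e∈M (e∈N refl))
... | no k≢i   = subst (λ M → e ∈ select β M) (sym (lookup∘updateAt′ k i k≢i d)) e∈M

change-preserves-covers : {α : Assignment n} {d d′ : Pairs n m} →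
                          AdmissibleChange α d d′ → Covers α d → Covers α d′
change-preserves-covers {α = α} {d} (remove i δ e _ δ≢αᵢ _) cov x with cov x
... | k , x∈M = k , ∈-replace⁺ d i δ k (lookup α k) x∈M
      -- The obligation is vacuous: the replaced set would have to be a covering set.
      λ { refl αᵢ≡δ → contradiction (sym αᵢ≡δ) δ≢αᵢ }
change-preserves-covers {α = α} {d} (add i δ e _) cov x with cov x
... | k , x∈M = k , ∈-replace⁺ d i δ k (lookup α k) x∈M
      λ { refl refl → p⊆p∪q ⁅ e ⁆ x∈M }
change-preserves-covers {α = α} {d} (move j γ i δ e _ refl _ _) cov x = moved
  where
  d₁ = replace d j γ (part d j γ - e)
  N  = part d i δ ∪ ⁅ e ⁆

  moved : ∃[ k ] x ∈ part (replace d₁ i δ N) k (lookup α k)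
  moved with x Fin.≟ e
  -- The moved element may lose its old witness `j`, so `i` is taken, whichever set covered it
  -- before.
  ... | yes refl = i , subst (x ∈_) (sym (part-replace d₁ i δ N))
                         (q⊆p∪q (part d i δ) ⁅ x ⁆ (x∈⁅x⁆ x))
  ... | no x≢e with cov x
  -- Any other element keeps its witness through both replacements. Since `N` is built from the set
  -- in `d`, not in `d₁`, the original `x∈M` discharges the second obligation too, even when `i` and
  -- `j` coincide.
  ... | k , x∈M = k , ∈-replace⁺ d₁ i δ k (lookup α k)
        (∈-replace⁺ d j γ k (lookup α k) x∈M λ { refl refl → x∈p∧x≢y⇒x∈p-y x∈M x≢e })
        λ { refl _ → p⊆p∪q ⁅ e ⁆ x∈M }

generated-preserves-covers : {α : Assignment n} {d d′ : Pairs n m} →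
                             GeneratedPairs α d d′ → Covers α d → Covers α d′
generated-preserves-covers ε        cov = cov
generated-preserves-covers (c ◅ cs) cov =
  generated-preserves-covers cs (change-preserves-covers c cov)

theorem4p2 : ∀ {n m : ℕ} (f : CNF n m) → IsCNF f →
    (σ : Assignment n) → eval f σ ≡ true →
    (h : CNF n m) → GeneratedFunction σ f h →
    Satisfiable h
theorem4p2 f _ σ fσ h gen = σ ,
  subst (λ g → eval g σ ≡ true) (sym h-generated)
    (covers⇒satisfied G σ (generated-preserves-covers G-generated (satisfied⇒covers f σ fσ)))
  where open GeneratedFunction gen
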